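{- $\mathrm{WL}_{3/2}\not\preceq\omega^{(\bullet)}$: there exist graphs $G$ and $H$ with $\omega^{(\bullet)}(G)=\omega^{(\bullet)}(H)$ (hence $\omega^{(r)}(G)=\omega^{(r)}(H)$ for every $r$) but $\mathrm{WL}_{3/2}(G)\ne\mathrm{WL}_{3/2}(H)$. (For instance, $G=G(A',B')$ and $H=G(A',A')$ where $A$ is the Shrikhande graph, $B$ the $4\times4$ rook's graph, each with one individualized port vertex.)
   Context: Graphs are finite, simple and undirected. Walk invariants: $w_k(x,y)$ = number of walks of length $k$ from $x$ to $y$ in an $N$-vertex graph, $w_*(x,y)=(w_0(x,y),\dots,w_{N-1}(x,y))$; $\omega_0(x)=w_*(x,x)$, $\omega_{r+1}(x)=\big(\omega_r(x),\{\!\{(w_*(x,y),\omega_r(y))\}\!\}_{y}\big)$ ($\{\!\{\cdot\}\!\}$ = multiset); $\omega^{(r)}(G)=\{\!\{\omega_r(x)\}\!\}_{x\in V(G)}$ and $\omega^{(\bullet)}(G)=\omega^{(N)}(G)$. Color refinement on a vertex-colored $N$-vertex graph: $C^0(x)$ is the color of $x$ (uniform if uncolored), $C^{r+1}(x)=\big(C^r(x),\{\!\{C^r(y)\}\!\}_{y\in N(x)}\big)$, $\mathrm{WL}_1(X)=\{\!\{C^N(x)\}\!\}_x$. $G_x$ is $G$ with $x$ given a special new color (same for all $x$); $\mathrm{WL}_{3/2}(G)=\{\!\{\mathrm{WL}_1(G_x)\}\!\}_{x\in V(G)}$. Construction $G(A',B')$ for graphs $A,B$ with individualized vertices $a_1,b_1$: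 the vertex-disjoint union of $A$ and $B$ plus a vertex $c_1$ adjacent to $a_1$ and $b_1$, plus a pendant vertex adjacent only to $c_1$; no colors. -}

module Defs where

open import Data.Bool.Base using (Bool)
open import Data.Empty using (⊥)
open import Data.Fin.Base using (Fin; zero; suc; toℕ; splitAt; remQuot)
open import Data.Fin.Properties using (_≟_; all?)
open import Data.List.Base using (List; []; _∷_; [_]; allFin; cartesianProductWith; filter; length; map)
open import Data.List.Relation.Binary.Permutation.Setoid using (↭-setoid)
import Data.List.Membership.DecPropositional as DecMembership
open import Data.Nat.Base using (ℕ; zero; suc; _+_; _∸_)
import Data.Nat.DivMod as ℕ
import Data.Nat.Properties as ℕ
open import Data.Product.Base using (_×_; _,_)
open import Data.Product.Properties using (≡-dec)
open import Data.Product.Relation.Binary.Pointwise.NonDependent using (_×ₛ_)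
open import Data.Sum.Base using (_⊎_; inj₁; inj₂)
open import Data.Unit.Base using (⊤)
open import Data.Vec.Base as Vec using (Vec; []; _∷_)
open import Data.Vec.Relation.Unary.Linked using (Linked; linked?)
open import Level using (0ℓ)
open import Relation.Binary using (Rel; Setoid; Decidable; Symmetric; Irreflexive)
open import Relation.Binary.PropositionalEquality using (_≡_; _≢_; refl; setoid)
open import Relation.Nullary.Decidable
  using (Dec; yes; no; does; from-yes; ¬?; _×-dec_; _⊎-dec_; _→-dec_)
open import Relation.Nullary.Negation using (¬_)

record Graph (n : ℕ) : Set₁ where
  field
    Adj         : Rel (Fin n) 0ℓ
    adj?        : Decidable Adj
    symmetric   : Symmetric Adj
    irreflexive : Irreflexive _≡_ Adj

  neighbours : Fin n → List (Fin n)
  neighbours x = filter (adj? x) (allFin n)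

open Graph public

-- Finite multisets are lists, compared up to a permutation that matches
-- elements up to the equality of S; this makes nested multisets meaningful.
Multiset : Setoid 0ℓ 0ℓ → Setoid 0ℓ 0ℓ
Multiset = ↭-setoid

------------------------------------------------------------------------
-- Walk invariants

sequences : ∀ n k → List (Vec (Fin n) k)
sequences n zero    = [ [] ]
sequences n (suc k) = cartesianProductWith _∷_ (allFin n) (sequences n k)

module _ {n : ℕ} (G : Graph n) where

  -- A walk of length k is given by its k + 1 successive vertices.
  IsWalk : ∀ {k} → Fin n → Fin n → Vec (Fin n) (suc k) → Set
  IsWalk x y v = Vec.head v ≡ x × Vec.last v ≡ y × Linked (Adj G) v

  isWalk? : ∀ {k} x y (v : Vec (Fin n) (suc k)) → Dec (IsWalk x y v)
  isWalk? x y v = Vec.head v ≟ x ×-dec Vec.last v ≟ y ×-dec linked? (adj? G) v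

  w : ℕ → Fin n → Fin n → ℕ
  w k x y = length (filter (isWalk? x y) (sequences n (suc k)))

  w* : Fin n → Fin n → Vec ℕ n
  w* x y = Vec.tabulate λ k → w (toℕ k) x y

WalkVector : ℕ → Setoid 0ℓ 0ℓ
WalkVector n = setoid (Vec ℕ n)

-- The values of ω r on graphs of order n.
Ω : ℕ → ℕ → Setoid 0ℓ 0ℓ
Ω n zero    = WalkVector n
Ω n (suc r) = Ω n r ×ₛ Multiset (WalkVector n ×ₛ Ω n r)

ω : ∀ {n} (G : Graph n) r → Fin n → Setoid.Carrier (Ω n r)
ω     G zero    x = w* G x x
ω {n} G (suc r) x = ω G r x , map (λ y → w* G x y , ω G r y) (allFin n)

ω⁽_⁾ : ∀ {n} r → Graph n → Setoid.Carrier (Multiset (Ω n r))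
ω⁽_⁾ {n} r G = map (ω G r) (allFin n)

ω⁽∙⁾ : ∀ {n} (G : Graph n) → Setoid.Carrier (Multiset (Ω n n))
ω⁽∙⁾ {n} G = ω⁽ n ⁾ G

SameΩ : ∀ {n} → ℕ → Rel (Graph n) 0ℓ
SameΩ {n} r G H = Setoid._≈_ (Multiset (Ω n r)) (ω⁽ r ⁾ G) (ω⁽ r ⁾ H)

SameΩ∙ : ∀ {n} → Rel (Graph n) 0ℓ
SameΩ∙ {n} G H = Setoid._≈_ (Multiset (Ω n n)) (ω⁽∙⁾ G) (ω⁽∙⁾ H)

------------------------------------------------------------------------
-- Color refinement

-- Colors after r rounds, starting from initial colors in K.
Color : Setoid 0ℓ 0ℓ → ℕ → Setoid 0ℓ 0ℓ
Color K zero    = K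
Color K (suc r) = Color K r ×ₛ Multiset (Color K r)

module _ (K : Setoid 0ℓ 0ℓ) {n : ℕ} (G : Graph n) (color : Fin n → Setoid.Carrier K) where

  C : ∀ r → Fin n → Setoid.Carrier (Color K r)
  C zero    x = color x
  C (suc r) x = C r x , map (C r) (neighbours G x)

  WL₁ : Setoid.Carrier (Multiset (Color K n))
  WL₁ = map (C n) (allFin n)

-- The coloring of G_x for an uncolored graph: true is the special color
-- of x, false the common color of all other vertices.
individualize : ∀ {n} → Fin n → Fin n → Bool
individualize x y = does (y ≟ x)

WL₃/₂-values : ℕ → Setoid 0ℓ 0ℓ
WL₃/₂-values n = Multiset (Multiset (Color (setoid Bool) n))

WL₃/₂ : ∀ {n} → Graph n → Setoid.Carrier (WL₃/₂-values n)
WL₃/₂ {n} G = map (λ x → WL₁ (setoid Bool) G (individualize x)) (allFin n)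

SameWL₃/₂ : ∀ {n} → Rel (Graph n) 0ℓ
SameWL₃/₂ {n} G H = Setoid._≈_ (WL₃/₂-values n) (WL₃/₂ G) (WL₃/₂ H)

-- G and H witness that WL₃/₂ is not bounded by ω⁽∙⁾.
Separates : ∀ {n} → Rel (Graph n) 0ℓ
Separates G H = SameΩ∙ G H × (∀ r → SameΩ r G H) × ¬ SameWL₃/₂ G H

------------------------------------------------------------------------
-- The construction G(A′,B′)

module Join {m n : ℕ} (A : Graph m) (a₁ : Fin m) (B : Graph n) (b₁ : Fin n) where

  data Vertex : Set where
    inA     : Fin m → Vertex
    inB     : Fin n → Vertex
    c₁      : Vertex
    pendant : Vertex

  vertex : Fin (2 + (m + n)) → Vertex
  vertex zero          = c₁
  vertex (suc zero)    = pendant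
  vertex (suc (suc i)) with splitAt m i
  ... | inj₁ x = inA x
  ... | inj₂ y = inB y

  Edge : Rel Vertex 0ℓ
  Edge (inA x) (inA y) = Adj A x y
  Edge (inB x) (inB y) = Adj B x y
  Edge (inA x) c₁      = x ≡ a₁
  Edge c₁      (inA x) = x ≡ a₁
  Edge (inB x) c₁      = x ≡ b₁
  Edge c₁      (inB x) = x ≡ b₁
  Edge c₁      pendant = ⊤
  Edge pendant c₁      = ⊤
  Edge _       _       = ⊥

  edge? : Decidable Edge
  edge? (inA x) (inA y) = adj? A x y
  edge? (inA x) (inB y) = no λ ()
  edge? (inA x) c₁      = x ≟ a₁
  edge? (inA x) pendant = no λ ()
  edge? (inB x) (inA y) = no λ ()
  edge? (inB x) (inB y) = adj? B x y
  edge? (inB x) c₁      = x ≟ b₁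
  edge? (inB x) pendant = no λ ()
  edge? c₁      (inA y) = y ≟ a₁
  edge? c₁      (inB y) = y ≟ b₁
  edge? c₁      c₁      = no λ ()
  edge? c₁      pendant = yes _
  edge? pendant (inA y) = no λ ()
  edge? pendant (inB y) = no λ ()
  edge? pendant c₁      = yes _
  edge? pendant pendant = no λ ()

  edge-sym : ∀ u v → Edge u v → Edge v u
  edge-sym (inA x) (inA y) e = symmetric A e
  edge-sym (inA x) c₁      e = e
  edge-sym (inB x) (inB y) e = symmetric B e
  edge-sym (inB x) c₁      e = e
  edge-sym c₁      (inA y) e = e
  edge-sym c₁      (inB y) e = e
  edge-sym c₁      pendant e = e
  edge-sym pendant c₁      e = e

  edge-irrefl : ∀ u → ¬ Edge u u
  edge-irrefl (inA x) = irreflexive A refl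
  edge-irrefl (inB x) = irreflexive B refl

  graph : Graph (2 + (m + n))
  graph .Adj i j              = Edge (vertex i) (vertex j)
  graph .adj? i j             = edge? (vertex i) (vertex j)
  graph .symmetric {i} {j}    = edge-sym (vertex i) (vertex j)
  graph .irreflexive {i} refl = edge-irrefl (vertex i)

open Join public using () renaming (graph to join)

------------------------------------------------------------------------
-- The Shrikhande graph and the 4 × 4 rook's graph

-- Vertices are the cells of a 4 × 4 grid.
cell : Fin 16 → Fin 4 × Fin 4
cell = remQuot 4

fromCells : (E : Rel (Fin 4 × Fin 4) 0ℓ) (E? : Decidable E) →
            (∀ x y → E (cell x) (cell y) → E (cell y) (cell x)) →
            (∀ x → ¬ E (cell x) (cell x)) → Graph 16
fromCells E E? s i .Adj x y             = E (cell x) (cell y)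
fromCells E E? s i .adj? x y            = E? (cell x) (cell y)
fromCells E E? s i .symmetric {x} {y}   = s x y
fromCells E E? s i .irreflexive {x} refl = i x

RookEdge : Rel (Fin 4 × Fin 4) 0ℓ
RookEdge (i , j) (k , l) = (i ≡ k × j ≢ l) ⊎ (i ≢ k × j ≡ l)

rookEdge? : Decidable RookEdge
rookEdge? (i , j) (k , l) =
  (i ≟ k ×-dec ¬? (j ≟ l)) ⊎-dec (¬? (i ≟ k) ×-dec j ≟ l)

rook : Graph 16
rook = fromCells RookEdge rookEdge?
  (from-yes (all? λ x → all? λ y →
    rookEdge? (cell x) (cell y) →-dec rookEdge? (cell y) (cell x)))
  (from-yes (all? λ x → ¬? (rookEdge? (cell x) (cell x))))

-- The Cayley graph of ℤ/4 × ℤ/4 with connection set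
-- ±(1 , 0), ±(0 , 1), ±(1 , 1).
connectionSet : List (ℕ × ℕ)
connectionSet =
  (1 , 0) ∷ (3 , 0) ∷ (0 , 1) ∷ (0 , 3) ∷ (1 , 1) ∷ (3 , 3) ∷ []

diff₄ : Fin 4 → Fin 4 → ℕ
diff₄ i j = (toℕ i + (4 ∸ toℕ j)) ℕ.% 4

open DecMembership (≡-dec ℕ._≟_ ℕ._≟_) using (_∈_; _∈?_)

ShrikhandeEdge : Rel (Fin 4 × Fin 4) 0ℓ
ShrikhandeEdge (i , j) (k , l) = (diff₄ i k , diff₄ j l) ∈ connectionSet

shrikhandeEdge? : Decidable ShrikhandeEdge
shrikhandeEdge? (i , j) (k , l) = (diff₄ i k , diff₄ j l) ∈? connectionSet

shrikhande : Graph 16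
shrikhande = fromCells ShrikhandeEdge shrikhandeEdge?
  (from-yes (all? λ x → all? λ y →
    shrikhandeEdge? (cell x) (cell y) →-dec shrikhandeEdge? (cell y) (cell x)))
  (from-yes (all? λ x → ¬? (shrikhandeEdge? (cell x) (cell x))))

{-# OPTIONS --safe #-}
module Submission where

-- Since A and B are strongly regular with the same parameters, in a join the numbers of walks to a
-- fixed vertex y are, as a function of x, determined by the distance from x to y (in the part of y)
-- and the distance from x to the port of its part: functions of this shape are preserved by the
-- adjacency matrix, through coefficients that depend only on the parameters. By the same regularity
-- the pairs (w_*(x,y), ω_r(y)) form a multiset that depends only on the distance from x to the port,
-- so every ω⁽ʳ⁾ agrees on the joins. Color refinement recognises the ports by their degree 7. With one
-- more vertex individualized it therefore detects a clique K₄ through a port, which the rook's graph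
-- has and the Shrikhande graph has not.

open import Defs
open import Data.Bool.Base using (Bool; true; false; if_then_else_)
open import Data.Empty using (⊥)
open import Data.Fin.Base as Fin using (Fin; zero; suc; toℕ; _↑ˡ_; _↑ʳ_)
open import Data.Fin.Properties using (_≟_; all?; any?; splitAt-↑ˡ; splitAt-↑ʳ; join-splitAt)
open import Data.List.Base
  using (List; []; _∷_; [_]; _++_; allFin; cartesianProductWith; filter; length; map; replicate; tabulate)
open import Data.List.Membership.Propositional using (_∈_; find)
import Data.List.Membership.DecPropositional as DecMembership
open import Data.List.Membership.Propositional.Properties
  using (∈-∃++; ∈-allFin; ∈-filter⁺; ∈-filter⁻; ∈-map⁺)
open import Data.List.Properties
  using (∷-injectiveˡ; ∷-injectiveʳ; filter-++; filter-none; filter-≐; length-++;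
         length-map; map-++; map-∘; map-cong; map-tabulate; tabulate-cong)
open import Data.List.Relation.Binary.Permutation.Propositional
  using (_↭_; refl; prep; trans; ↭-sym; ↭-reflexive; ↭⇒↭ₛ; module PermutationReasoning)
open import Data.List.Relation.Binary.Permutation.Propositional.Properties
  using (map⁺; ↭-map-inv; ∈-resp-↭; shift; drop-∷; ++⁺)
import Data.List.Relation.Binary.Permutation.Setoid as Permₛ
import Data.List.Relation.Binary.Permutation.Setoid.Properties as Permₛ
open import Data.List.Relation.Unary.All using (universal)
open import Data.List.Relation.Unary.Any as Any using (here)
import Data.List.Relation.Unary.Any.Properties as Any
import Data.List.Relation.Binary.Pointwise as Pointwise
open import Data.Nat.Base using (ℕ; zero; suc; _+_)
open import Data.Nat.ListAction using (sum)
open import Data.Nat.ListAction.Properties using (sum-++; sum-↭)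
open import Data.Nat.Properties using (+-identityʳ)
open import Data.Nat.Tactic.RingSolver using (solve-∀)
open import Data.Product.Base using (_×_; _,_; proj₁; proj₂; ∃₂; ∃-syntax)
open import Data.Product.Properties using (≡-dec)
open import Data.Product.Relation.Binary.Pointwise.NonDependent using (_×ₛ_)
open import Data.Sum.Base using (_⊎_; inj₁; inj₂)
open import Data.Unit.Base using (⊤; tt)
open import Data.Vec.Base as Vec using (Vec; []; _∷_)
import Data.Vec.Properties as Vec
open import Data.Vec.Relation.Unary.Linked using (Linked; linked?; [-]; _∷_)
open import Function.Base using (_∘_; id)
open import Function.Bundles using (mk⇔)
open import Level using (0ℓ)
open import Relation.Binary using (Setoid; DecidableEquality)
open import Relation.Binary.PropositionalEquality
  using (_≡_; refl; sym; cong; cong₂; subst₂; setoid; _≗_; module ≡-Reasoning)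
  renaming (trans to ≡-trans)
open import Relation.Nullary.Decidable
  using (Dec; yes; no; does; does-⇔; dec-true; dec-false; from-yes; map′; ¬?; _×-dec_)
open import Relation.Nullary.Negation using (¬_; contradiction)
open import Relation.Unary using (Pred; Decidable)

private variable
  X Y Z : Set

-- Sums over lists

infixr 7 _when_

_when_ : ℕ → Bool → ℕ
n when b = if b then n else 0

∑ : List X → (X → ℕ) → ℕ
∑ xs f = sum (map f xs)

∑-cong : ∀ {f g : X → ℕ} → f ≗ g → ∀ xs → ∑ xs f ≡ ∑ xs g
∑-cong f≗g xs = cong sum (map-cong f≗g xs)

∑-++ : ∀ (f : X → ℕ) xs ys → ∑ (xs ++ ys) f ≡ ∑ xs f + ∑ ys f
∑-++ f xs ys = ≡-trans (cong sum (map-++ f xs ys)) (sum-++ (map f xs) (map f ys))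

∑-map : ∀ (f : Y → ℕ) (g : X → Y) xs → ∑ (map g xs) f ≡ ∑ xs (f ∘ g)
∑-map f g xs = cong sum (sym (map-∘ xs))

∑-↭ : ∀ (f : X → ℕ) {xs ys} → xs ↭ ys → ∑ xs f ≡ ∑ ys f
∑-↭ f xs↭ys = sum-↭ (map⁺ f xs↭ys)

∑-zero : ∀ (xs : List X) → ∑ xs (λ _ → 0) ≡ 0
∑-zero []       = refl
∑-zero (_ ∷ xs) = ∑-zero xs

∑-when-+ : ∀ (f g : X → ℕ) (b : X → Bool) xs →
  ∑ xs (λ x → (f x + g x) when b x) ≡ ∑ xs (λ x → f x when b x) + ∑ xs (λ x → g x when b x)
∑-when-+ f g b []       = refl
∑-when-+ f g b (x ∷ xs) with b x
... | false = ∑-when-+ f g b xs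
... | true  = ≡-trans (cong (f x + g x +_) (∑-when-+ f g b xs)) (interchange (f x) (g x) _ _)
  where
  interchange : ∀ p q r s → p + q + (r + s) ≡ p + r + (q + s)
  interchange = solve-∀

∑-allFin : ∀ {n} (f : Fin n → ℕ) → ∑ (allFin n) f ≡ sum (tabulate f)
∑-allFin f = cong sum (map-tabulate id f)

∑-select : ∀ {n} (f : Fin n → ℕ) x → ∑ (allFin n) (λ z → f z when does (z ≟ x)) ≡ f x
∑-select f x = ≡-trans (∑-allFin (λ z → f z when does (z ≟ x))) (select f x)
  where
  open ≡-Reasoning
  select : ∀ {n} (f : Fin n → ℕ) x → sum (tabulate λ z → f z when does (z ≟ x)) ≡ f x
  select {suc n} f zero = begin
    f zero + sum (tabulate {n = n} λ _ → 0)  ≡⟨ cong (f zero +_) (∑-allFin {n} (λ _ → 0)) ⟨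
    f zero + ∑ (allFin n) (λ _ → 0)          ≡⟨ cong (f zero +_) (∑-zero (allFin n)) ⟩
    f zero + 0                               ≡⟨ +-identityʳ (f zero) ⟩
    f zero                                   ∎
  select f (suc x) = select (f ∘ suc) x

length-filter-∑ : ∀ {P : Pred X 0ℓ} (P? : Decidable P) xs →
  length (filter P? xs) ≡ ∑ xs (λ x → 1 when does (P? x))
length-filter-∑ P? []       = refl
length-filter-∑ P? (x ∷ xs) with does (P? x)
... | false = length-filter-∑ P? xs
... | true  = cong suc (length-filter-∑ P? xs)

length-filter-map : ∀ {P : Pred Y 0ℓ} (P? : Decidable P) (f : X → Y) xs →
  length (filter P? (map f xs)) ≡ length (filter (P? ∘ f) xs)
length-filter-map P? f xs = begin
  length (filter P? (map f xs))           ≡⟨ length-filter-∑ P? (map f xs) ⟩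
  ∑ (map f xs) (λ y → 1 when does (P? y)) ≡⟨ ∑-map _ f xs ⟩
  ∑ xs (λ x → 1 when does (P? (f x)))     ≡⟨ length-filter-∑ (P? ∘ f) xs ⟨
  length (filter (P? ∘ f) xs)             ∎
  where open ≡-Reasoning

length-filter-cartesianProductWith : ∀ {P : Pred Z 0ℓ} (P? : Decidable P) (f : X → Y → Z) xs ys →
  length (filter P? (cartesianProductWith f xs ys)) ≡ ∑ xs (λ x → length (filter (P? ∘ f x) ys))
length-filter-cartesianProductWith P? f []       ys = refl
length-filter-cartesianProductWith P? f (x ∷ xs) ys = begin
  length (filter P? (map (f x) ys ++ rest))                   ≡⟨ cong length (filter-++ P? (map (f x) ys) rest) ⟩
  length (filter P? (map (f x) ys) ++ filter P? rest)         ≡⟨ length-++ (filter P? (map (f x) ys)) ⟩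
  length (filter P? (map (f x) ys)) + length (filter P? rest)
    ≡⟨ cong₂ _+_ (length-filter-map P? (f x) ys) (length-filter-cartesianProductWith P? f xs ys) ⟩
  ∑ (x ∷ xs) (λ x → length (filter (P? ∘ f x) ys))            ∎
  where
  open ≡-Reasoning
  rest = cartesianProductWith f xs ys

-- `A` does not depend on the list element, so it leaves the count as a factor. This is how the
-- start vertex and the first edge of a walk are split off.
length-filter-× : ∀ {A : Set} {P Q : Pred X 0ℓ} (A? : Dec A) (P? : Decidable P) (Q? : Decidable Q) →
  (∀ {x} → P x → A × Q x) → (∀ {x} → A → Q x → P x) →
  ∀ xs → length (filter P? xs) ≡ length (filter Q? xs) when does A?
length-filter-× (yes a) P? Q? P⇒ ⇒P xs =
  cong length (filter-≐ P? Q? (proj₂ ∘ P⇒ , ⇒P a) xs)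
length-filter-× (no ¬a) P? Q? P⇒ ⇒P xs =
  cong length (filter-none P? (universal (λ _ → ¬a ∘ proj₁ ∘ P⇒) xs))

-- Walk counts as powers of the adjacency matrix

module _ {n : ℕ} (G : Graph n) where

  private
    continues? : ∀ {k} x y (v : Vec (Fin n) k) → Dec (Vec.last (x ∷ v) ≡ y × Linked (Adj G) (x ∷ v))
    continues? x y v = Vec.last (x ∷ v) ≟ y ×-dec linked? (adj? G) (x ∷ v)

    -- The head of a walk can only be `x`, so the sum over heads has one nonzero term; in the count
    -- of tails the recursion on `k` becomes visible.
    w-continues : ∀ k x y → w G k x y ≡ length (filter (continues? x y) (sequences n k))
    w-continues k x y = begin
      w G k x y
        ≡⟨ length-filter-cartesianProductWith (isWalk? G x y) _∷_ (allFin n) (sequences n k) ⟩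
      ∑ (allFin n) (λ z → length (filter (isWalk? G x y ∘ (z ∷_)) (sequences n k)))
        ≡⟨ ∑-cong (λ z → length-filter-× (z ≟ x) (isWalk? G x y ∘ (z ∷_)) (continues? z y)
                           id _,_ (sequences n k)) (allFin n) ⟩
      ∑ (allFin n) (λ z → length (filter (continues? z y) (sequences n k)) when does (z ≟ x))
        ≡⟨ ∑-select (λ z → length (filter (continues? z y) (sequences n k))) x ⟩
      length (filter (continues? x y) (sequences n k)) ∎
      where open ≡-Reasoning

  w-zero : ∀ x y → w G 0 x y ≡ 1 when does (x ≟ y)
  w-zero x y = ≡-trans (w-continues 0 x y) (base (x ≟ y))
    where
    base : (d : Dec (x ≡ y)) → length (filter (continues? x y) [ [] ]) ≡ 1 when does d
    -- The single sequence `[]` passes the trivial test, so the count is the indicator of `x ≡ y`.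
    base d = length-filter-× d (continues? x y) (λ _ → yes tt)
               (λ {_} p → lastEq p , tt) (λ {v} e _ → unique v e) [ [] ]
      where
      lastEq : ∀ {v : Vec (Fin n) 0} → Vec.last (x ∷ v) ≡ y × Linked (Adj G) (x ∷ v) → x ≡ y
      lastEq {[]} = proj₁
      unique : ∀ (v : Vec (Fin n) 0) → x ≡ y → Vec.last (x ∷ v) ≡ y × Linked (Adj G) (x ∷ v)
      unique [] e = e , [-]

  -- Split at the second vertex `z`: the first edge becomes the factor after `when`, and the rest is
  -- a walk from `z` to `y`.
  w-suc : ∀ k x y → w G (suc k) x y ≡ ∑ (allFin n) (λ z → w G k z y when does (adj? G x z))
  w-suc k x y = begin
    w G (suc k) x y
      ≡⟨ w-continues (suc k) x y ⟩
    length (filter (continues? x y) (sequences n (suc k)))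
      ≡⟨ length-filter-cartesianProductWith (continues? x y) _∷_ (allFin n) (sequences n k) ⟩
    ∑ (allFin n) (λ z → length (filter (continues? x y ∘ (z ∷_)) (sequences n k)))
      ≡⟨ ∑-cong (λ z → length-filter-× (adj? G x z) (continues? x y ∘ (z ∷_)) (continues? z y)
                         (λ { (l , e ∷ es) → e , l , es }) (λ { e (l , es) → l , e ∷ es })
                         (sequences n k)) (allFin n) ⟩
    ∑ (allFin n) (λ z → length (filter (continues? z y) (sequences n k)) when does (adj? G x z))
      ≡⟨ ∑-cong (λ z → cong (_when does (adj? G x z)) (w-continues k z y)) (allFin n) ⟨
    ∑ (allFin n) (λ z → w G k z y when does (adj? G x z)) ∎
    where open ≡-Reasoning

-- Strongly regular graphs as association schemes with two classes

data Distance : Set where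
  same adjacent far : Distance

isSame isAdjacent : Distance → Bool
isSame same = true
isSame _    = false
isAdjacent adjacent = true
isAdjacent _        = false

_≟ᵈ_ : DecidableEquality Distance
same     ≟ᵈ same     = yes refl
same     ≟ᵈ adjacent = no λ ()
same     ≟ᵈ far      = no λ ()
adjacent ≟ᵈ same     = no λ ()
adjacent ≟ᵈ adjacent = yes refl
adjacent ≟ᵈ far      = no λ ()
far      ≟ᵈ same     = no λ ()
far      ≟ᵈ adjacent = no λ ()
far      ≟ᵈ far      = yes refl

module _ {n : ℕ} (G : Graph n) where

  distance : Fin n → Fin n → Distance
  distance x y = if does (x ≟ y) then same else if does (adj? G x y) then adjacent else far

  distance-refl : ∀ x → distance x x ≡ same
  distance-refl x rewrite dec-true (x ≟ x) refl = refl

  distance-sym : ∀ x y → distance x y ≡ distance y x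
  distance-sym x y
    rewrite does-⇔ (mk⇔ sym sym) (x ≟ y) (y ≟ x)
          | does-⇔ (mk⇔ (symmetric G) (symmetric G)) (adj? G x y) (adj? G y x) = refl

  isSame-distance : ∀ x y → does (x ≟ y) ≡ isSame (distance x y)
  isSame-distance x y with does (x ≟ y) | does (adj? G x y)
  ... | true  | _     = refl
  ... | false | true  = refl
  ... | false | false = refl

  isAdjacent-distance : ∀ x y → does (adj? G x y) ≡ isAdjacent (distance x y)
  isAdjacent-distance x y with x ≟ y
  -- `distance` answers `same` before it tests adjacency, so on the diagonal the agreement rests on
  -- irreflexivity.
  ... | yes refl = dec-false (adj? G x x) (irreflexive G refl)
  ... | no _ with does (adj? G x y)
  ...   | true  = refl
  ...   | false = refl

-- The intersection numbers of the scheme, kept as lists of pairs: the same data then serves the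
-- sums over neighbours and the multisets inside `ω`.
IntersectionTable : Set
IntersectionTable = Distance → List (Distance × Distance)

_HasIntersections_ : ∀ {n} → Graph n → IntersectionTable → Set
_HasIntersections_ {n} G table =
  ∀ x y → map (λ z → distance G x z , distance G z y) (allFin n) ↭ table (distance G x y)

-- The action of the adjacency matrix on functions of the distance to a fixed vertex.
spread : IntersectionTable → (Distance → ℕ) → Distance → ℕ
spread table f d = ∑ (table d) (λ (s , t) → f t when isAdjacent s)

-- The summand depends on `z` only through its distances from `x` and to `y`, and the table
-- prescribes the multiset of these pairs.
∑-neighbours : ∀ {n} (G : Graph n) {table} → G HasIntersections table → ∀ f x y →
  ∑ (allFin n) (λ z → f (distance G z y) when does (adj? G x z)) ≡ spread table f (distance G x y)
∑-neighbours {n} G {table} G-table f x y = begin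
  ∑ (allFin n) (λ z → f (distance G z y) when does (adj? G x z))
    ≡⟨ ∑-cong (λ z → cong (f (distance G z y) when_) (isAdjacent-distance G x z)) (allFin n) ⟩
  ∑ (allFin n) (weight ∘ λ z → distance G x z , distance G z y)
    ≡⟨ ∑-map weight (λ z → distance G x z , distance G z y) (allFin n) ⟨
  ∑ (map (λ z → distance G x z , distance G z y) (allFin n)) weight
    ≡⟨ ∑-↭ weight (G-table x y) ⟩
  spread table f (distance G x y) ∎
  where
  open ≡-Reasoning
  weight : Distance × Distance → ℕ
  weight (s , t) = f t when isAdjacent s

-- Deciding permutations, and the two strongly regular graphs

module _ (_≟ˣ_ : DecidableEquality X) where

  open DecMembership _≟ˣ_ using (_∈?_)

  -- Greedy removal never has to backtrack, because a common element can be cancelled from a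
  -- permutation.
  _↭?_ : (xs ys : List X) → Dec (xs ↭ ys)
  []       ↭? []       = yes refl
  []       ↭? (y ∷ ys) = no λ p → contradiction (∈-resp-↭ (↭-sym p) (here refl)) λ ()
  (x ∷ xs) ↭? ys with x ∈? ys
  ... | no x∉ys  = no λ p → x∉ys (∈-resp-↭ p (here refl))
  ... | yes x∈ys with ∈-∃++ x∈ys
  ...   | as , bs , refl = map′ (λ p → trans (prep x p) (↭-sym (shift x as bs)))
                                (λ p → drop-∷ (trans p (shift x as bs)))
                                (xs ↭? (as ++ bs))

-- Order 16, degree 6, and both λ and μ equal to 2, the entries `replicate 2`. The mixed entries are
-- 6 - 1 - λ = 3 and 6 - μ = 4; the pairs `(far , far)` bring each row to 16.
srg-16-6-2-2 : IntersectionTable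
srg-16-6-2-2 same     = (same , same) ∷ replicate 6 (adjacent , adjacent) ++ replicate 9 (far , far)
srg-16-6-2-2 adjacent = (same , adjacent) ∷ (adjacent , same) ∷ replicate 2 (adjacent , adjacent)
  ++ replicate 3 (adjacent , far) ++ replicate 3 (far , adjacent) ++ replicate 6 (far , far)
srg-16-6-2-2 far      = (same , far) ∷ (far , same) ∷ replicate 2 (adjacent , adjacent)
  ++ replicate 4 (adjacent , far) ++ replicate 4 (far , adjacent) ++ replicate 4 (far , far)

hasIntersections? : ∀ {n} (G : Graph n) table → Dec (G HasIntersections table)
hasIntersections? G table = all? λ x → all? λ y → _↭?_ (≡-dec _≟ᵈ_ _≟ᵈ_) _ (table (distance G x y))

rook-srg : rook HasIntersections srg-16-6-2-2
rook-srg = from-yes (hasIntersections? rook srg-16-6-2-2)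

shrikhande-srg : shrikhande HasIntersections srg-16-6-2-2
shrikhande-srg = from-yes (hasIntersections? shrikhande srg-16-6-2-2)

-- ω from a colouring of pairs of vertices

-- A permutation of the labels `f` and `g` pulls back to one of the underlying elements, and along
-- it `h` and `h′` agree. Thus propositional permutations of labels yield equality of nested
-- multisets.
map-↭ₛ : ∀ (S : Setoid 0ℓ 0ℓ) → let open Setoid S in
  ∀ {f : X → Z} {g : Y → Z} {h : X → Carrier} {h′ : Y → Carrier} →
  (∀ {x y} → f x ≡ g y → h x ≈ h′ y) → ∀ xs ys →
  map f xs ↭ map g ys → Setoid._≈_ (Multiset S) (map h xs) (map h′ ys)
map-↭ₛ {X = X} {Y = Y} S {f} {g} {h} {h′} f≡g⇒h≈h′ xs ys p with ↭-map-inv f p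
... | xs′ , gys≡fxs′ , xs↭xs′ =
  Permₛ.trans (Permₛ.map⁺ (setoid X) S (S.reflexive ∘ cong h) (↭⇒↭ₛ xs↭xs′))
              (Permₛ.refl (Pointwise.map⁺ h h′ (pointwise xs′ ys gys≡fxs′)))
  where
  module S = Setoid S
  pointwise : ∀ xs ys → map g ys ≡ map f xs → Pointwise.Pointwise (λ x y → h x S.≈ h′ y) xs ys
  pointwise []       []       _  = Pointwise.[]
  pointwise (x ∷ xs) (y ∷ ys) eq =
    f≡g⇒h≈h′ (sym (∷-injectiveˡ eq)) Pointwise.∷ pointwise xs ys (∷-injectiveʳ eq)

module _ {n : ℕ} (G H : Graph n) {K P : Set}
  (kindᴳ : Fin n → K) (kindᴴ : Fin n → K) (pairᴳ : Fin n → Fin n → P) (pairᴴ : Fin n → Fin n → P)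
  (loops   : ∀ {x x′} → kindᴳ x ≡ kindᴴ x′ → pairᴳ x x ≡ pairᴴ x′ x′)
  (targets : ∀ {x y x′ y′} → pairᴳ x y ≡ pairᴴ x′ y′ → kindᴳ y ≡ kindᴴ y′)
  (walks   : ∀ {x y x′ y′} → pairᴳ x y ≡ pairᴴ x′ y′ → ∀ k → w G k x y ≡ w H k x′ y′)
  (pairs   : ∀ {x x′} → kindᴳ x ≡ kindᴴ x′ → map (pairᴳ x) (allFin n) ↭ map (pairᴴ x′) (allFin n))
  (kinds   : map kindᴳ (allFin n) ↭ map kindᴴ (allFin n))
  where

  private
    w*-pair : ∀ {x y x′ y′} → pairᴳ x y ≡ pairᴴ x′ y′ → w* G x y ≡ w* H x′ y′
    w*-pair eq = Vec.tabulate-cong λ k → walks eq (toℕ k)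

    -- The labels act like a coherent configuration shared by both graphs. `loops` and `walks`
    -- settle round 0; in a further round `pairs` matches the vertices `y`, `walks` equates their
    -- walk vectors and `targets` makes the induction hypothesis apply to them.
    ω-kind : ∀ r {x x′} → kindᴳ x ≡ kindᴴ x′ → Setoid._≈_ (Ω n r) (ω G r x) (ω H r x′)
    ω-kind zero    eq = w*-pair (loops eq)
    ω-kind (suc r) eq =
      ω-kind r eq ,
      map-↭ₛ (WalkVector n ×ₛ Ω n r) (λ e → w*-pair e , ω-kind r (targets e))
             (allFin n) (allFin n) (pairs eq)

  sameΩ : ∀ r → SameΩ r G H
  sameΩ r = map-↭ₛ (Ω n r) (ω-kind r) (allFin n) (allFin n) kinds

tabulate-+ : ∀ m {n} (f : Fin (m + n) → X) →
  tabulate f ≡ tabulate (λ x → f (x ↑ˡ n)) ++ tabulate (λ y → f (m ↑ʳ y))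
tabulate-+ zero    f = refl
tabulate-+ (suc m) f = cong (f zero ∷_) (tabulate-+ m (f ∘ suc))

-- Walks in a join

-- The kind of a vertex of a join: for vertices of A and B the distance to the port.
data Kind : Set where
  inA inB    : Distance → Kind
  c₁ pendant : Kind

PairType : Set
PairType = Kind × Kind × Distance

-- A function on the vertices of the join of A and B, of the shape preserved by the adjacency matrix:
-- on A it is the sum of a function αᴬ of the distance to a chosen vertex of A and a function βᴬ of
-- the distance to the port, and similarly on B.
record Column : Set where
  field
    αᴬ βᴬ αᴮ βᴮ : Distance → ℕ
    γ δ         : ℕ

open Column

evaluate : Column → Kind → Distance → ℕ
evaluate κ (inA e) d = αᴬ κ d + βᴬ κ e
evaluate κ (inB e) d = αᴮ κ d + βᴮ κ e
evaluate κ c₁      d = γ κ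
evaluate κ pendant d = δ κ

-- In the arguments of step, s and t are the distances from the ports to the chosen vertices.
step : (tableᴬ tableᴮ : IntersectionTable) (s t : Distance) → Column → Column
step tableᴬ tableᴮ s t κ = λ where
  .αᴬ   → spread tableᴬ (αᴬ κ)
  .βᴬ d → γ κ when isSame d + spread tableᴬ (βᴬ κ) d
  .αᴮ   → spread tableᴮ (αᴮ κ)
  .βᴮ d → γ κ when isSame d + spread tableᴮ (βᴮ κ) d
  .γ    → δ κ + (evaluate κ (inA same) s + evaluate κ (inB same) t)
  .δ    → γ κ

-- The columns of the identity matrix. The distance inside the kind does not enter, as `αᴬ` and `αᴮ`
-- are measured from the chosen vertex.
unit : Kind → Column
unit (inA _) = λ where .αᴬ d → 1 when isSame d ; .βᴬ _ → 0 ; .αᴮ _ → 0 ; .βᴮ _ → 0 ; .γ → 0 ; .δ → 0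
unit (inB _) = λ where .αᴬ _ → 0 ; .βᴬ _ → 0 ; .αᴮ d → 1 when isSame d ; .βᴮ _ → 0 ; .γ → 0 ; .δ → 0
unit c₁      = λ where .αᴬ _ → 0 ; .βᴬ _ → 0 ; .αᴮ _ → 0 ; .βᴮ _ → 0 ; .γ → 1 ; .δ → 0
unit pendant = λ where .αᴬ _ → 0 ; .βᴬ _ → 0 ; .αᴮ _ → 0 ; .βᴮ _ → 0 ; .γ → 0 ; .δ → 1

-- The default `same` reflects that in a part without the vertex the port itself is the chosen
-- vertex.
portDistanceᴬ portDistanceᴮ : Kind → Distance
portDistanceᴬ (inA d) = d
portDistanceᴬ _       = same
portDistanceᴮ (inB d) = d
portDistanceᴮ _       = same

column : (tableᴬ tableᴮ : IntersectionTable) → ℕ → Kind → Column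
column tableᴬ tableᴮ zero    t = unit t
column tableᴬ tableᴮ (suc k) t =
  step tableᴬ tableᴮ (portDistanceᴬ t) (portDistanceᴮ t) (column tableᴬ tableᴮ k t)

-- The gap to a vertex in another part is by convention measured to the port of one's own part.
gapᴬ gapᴮ : Kind → Distance → Distance
gapᴬ (inA _) s = s
gapᴬ (inB d) s = d
gapᴬ _       s = same
gapᴮ (inB _) s = s
gapᴮ (inA d) s = d
gapᴮ _       s = same

pairTypes : (tableᴬ tableᴮ : IntersectionTable) → Kind → List PairType
pairTypes tableᴬ tableᴮ k =
  (k , c₁ , gap) ∷ (k , pendant , gap) ∷
  map (λ (s , t) → k , inA t , gapᴬ k s) (tableᴬ (portDistanceᴬ k)) ++
  map (λ (s , t) → k , inB t , gapᴮ k s) (tableᴮ (portDistanceᴮ k))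
  where
  gap : Distance
  -- The targets `c₁` and `pendant` have both ports as anchors. One formula covers both parts, since
  -- `gapᴬ (inB d)` returns `d` as well.
  gap = gapᴬ k (portDistanceᴬ k)

-- The vertices of a join and the labels of their pairs

module _ {m n : ℕ} (A : Graph m) (a : Fin m) (B : Graph n) (b : Fin n) where

  open Join A a B b hiding (graph)

  private
    _≟ᵛ_ : DecidableEquality Vertex
    inA x   ≟ᵛ inA y   = map′ (cong inA) (λ { refl → refl }) (x ≟ y)
    inA x   ≟ᵛ inB y   = no λ ()
    inA x   ≟ᵛ c₁      = no λ ()
    inA x   ≟ᵛ pendant = no λ ()
    inB x   ≟ᵛ inA y   = no λ ()
    inB x   ≟ᵛ inB y   = map′ (cong inB) (λ { refl → refl }) (x ≟ y)
    inB x   ≟ᵛ c₁      = no λ ()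
    inB x   ≟ᵛ pendant = no λ ()
    c₁      ≟ᵛ inA y   = no λ ()
    c₁      ≟ᵛ inB y   = no λ ()
    c₁      ≟ᵛ c₁      = yes refl
    c₁      ≟ᵛ pendant = no λ ()
    pendant ≟ᵛ inA y   = no λ ()
    pendant ≟ᵛ inB y   = no λ ()
    pendant ≟ᵛ c₁      = no λ ()
    pendant ≟ᵛ pendant = yes refl

    index : Vertex → Fin (2 + (m + n))
    index c₁      = zero
    index pendant = suc zero
    index (inA x) = suc (suc (x ↑ˡ n))
    index (inB y) = suc (suc (m ↑ʳ y))

    index-vertex : ∀ i → index (vertex i) ≡ i
    index-vertex zero          = refl
    index-vertex (suc zero)    = refl
    index-vertex (suc (suc i)) with Fin.splitAt m i | join-splitAt m n i
    ... | inj₁ x | eq = cong (λ j → suc (suc j)) eq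
    ... | inj₂ y | eq = cong (λ j → suc (suc j)) eq

  vertex-injective : ∀ {i j} → vertex i ≡ vertex j → i ≡ j
  vertex-injective {i} {j} eq =
    ≡-trans (sym (index-vertex i)) (≡-trans (cong index eq) (index-vertex j))

  vertex-↑ˡ : ∀ x → vertex (suc (suc (x ↑ˡ n))) ≡ inA x
  vertex-↑ˡ x rewrite splitAt-↑ˡ m x n = refl

  vertex-↑ʳ : ∀ y → vertex (suc (suc (m ↑ʳ y))) ≡ inB y
  vertex-↑ʳ y rewrite splitAt-↑ʳ m n y = refl

  vertices : List Vertex
  vertices = c₁ ∷ pendant ∷ map inA (allFin m) ++ map inB (allFin n)

  map-vertex : map vertex (allFin (2 + (m + n))) ≡ vertices
  map-vertex = begin
    map vertex (allFin (2 + (m + n)))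
      ≡⟨ map-tabulate id vertex ⟩
    c₁ ∷ pendant ∷ tabulate (λ i → vertex (suc (suc i)))
      ≡⟨ cong (λ vs → c₁ ∷ pendant ∷ vs) (tabulate-+ m (λ i → vertex (suc (suc i)))) ⟩
    c₁ ∷ pendant ∷ tabulate (λ x → vertex (suc (suc (x ↑ˡ n)))) ++ tabulate (λ y → vertex (suc (suc (m ↑ʳ y))))
      ≡⟨ cong₂ (λ xs ys → c₁ ∷ pendant ∷ xs ++ ys)
           (≡-trans (tabulate-cong vertex-↑ˡ) (sym (map-tabulate id inA)))
           (≡-trans (tabulate-cong vertex-↑ʳ) (sym (map-tabulate id inB))) ⟩
    vertices ∎
    where open ≡-Reasoning

  ∑-vertices : ∀ g → ∑ vertices g ≡ g c₁ + (g pendant + (∑ (allFin m) (g ∘ inA) + ∑ (allFin n) (g ∘ inB)))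
  ∑-vertices g = cong (λ s → g c₁ + (g pendant + s)) (begin
    ∑ (map inA (allFin m) ++ map inB (allFin n)) g     ≡⟨ ∑-++ g (map inA (allFin m)) (map inB (allFin n)) ⟩
    ∑ (map inA (allFin m)) g + ∑ (map inB (allFin n)) g
      ≡⟨ cong₂ _+_ (∑-map g inA (allFin m)) (∑-map g inB (allFin n)) ⟩
    ∑ (allFin m) (g ∘ inA) + ∑ (allFin n) (g ∘ inB)    ∎)
    where open ≡-Reasoning

  kind : Vertex → Kind
  kind (inA x) = inA (distance A x a)
  kind (inB y) = inB (distance B y b)
  kind c₁      = c₁
  kind pendant = pendant

  gap : Fin m → Fin n → Vertex → Distance
  gap x₀ y₀ (inA x) = distance A x x₀
  gap x₀ y₀ (inB y) = distance B y y₀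
  gap x₀ y₀ _       = same

  -- A column needs a chosen vertex in each part. In a part without the target it is the port, so
  -- that no new distance arises.
  anchorᴬ : Vertex → Fin m
  anchorᴬ (inA x) = x
  anchorᴬ _       = a

  anchorᴮ : Vertex → Fin n
  anchorᴮ (inB y) = y
  anchorᴮ _       = b

  -- The two kinds alone cannot tell, say, equal from adjacent vertices of one part; the gap
  -- supplies this.
  pairType : Vertex → Vertex → PairType
  pairType u v = kind u , kind v , gap (anchorᴬ v) (anchorᴮ v) u

  value : Column → Fin m → Fin n → Vertex → ℕ
  value κ x₀ y₀ u = evaluate κ (kind u) (gap x₀ y₀ u)

  distance-anchorᴬ : ∀ v → distance A (anchorᴬ v) a ≡ portDistanceᴬ (kind v)
  distance-anchorᴬ (inA x) = refl
  distance-anchorᴬ (inB y) = distance-refl A a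
  distance-anchorᴬ c₁      = distance-refl A a
  distance-anchorᴬ pendant = distance-refl A a

  distance-anchorᴮ : ∀ v → distance B (anchorᴮ v) b ≡ portDistanceᴮ (kind v)
  distance-anchorᴮ (inB y) = refl
  distance-anchorᴮ (inA x) = distance-refl B b
  distance-anchorᴮ c₁      = distance-refl B b
  distance-anchorᴮ pendant = distance-refl B b

  pairType-loop : ∀ u → pairType u u ≡ (kind u , kind u , same)
  pairType-loop (inA x) = cong (λ d → kind (inA x) , kind (inA x) , d) (distance-refl A x)
  pairType-loop (inB y) = cong (λ d → kind (inB y) , kind (inB y) , d) (distance-refl B y)
  pairType-loop c₁      = refl
  pairType-loop pendant = refl

  ∑-adjacent : ∀ (f : Vertex → ℕ) i →
    ∑ (allFin (2 + (m + n))) (λ z → f (vertex z) when does (adj? (join A a B b) i z)) ≡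
    ∑ vertices (λ v → f v when does (edge? (vertex i) v))
  ∑-adjacent f i = begin
    ∑ (allFin (2 + (m + n))) (g ∘ vertex)   ≡⟨ ∑-map g vertex (allFin (2 + (m + n))) ⟨
    ∑ (map vertex (allFin (2 + (m + n)))) g ≡⟨ cong (λ vs → ∑ vs g) map-vertex ⟩
    ∑ vertices g                            ∎
    where
    open ≡-Reasoning
    g : Vertex → ℕ
    g v = f v when does (edge? (vertex i) v)

  value-unit : ∀ u v → 1 when does (u ≟ᵛ v) ≡ value (unit (kind v)) (anchorᴬ v) (anchorᴮ v) u
  value-unit (inA x) (inA y) =
    ≡-trans (cong (1 when_) (isSame-distance A x y)) (sym (+-identityʳ _))
  value-unit (inB x) (inB y) =
    ≡-trans (cong (1 when_) (isSame-distance B x y)) (sym (+-identityʳ _))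
  value-unit (inA x) (inB y) = refl
  value-unit (inA x) c₁      = refl
  value-unit (inA x) pendant = refl
  value-unit (inB x) (inA y) = refl
  value-unit (inB x) c₁      = refl
  value-unit (inB x) pendant = refl
  value-unit c₁      (inA y) = refl
  value-unit c₁      (inB y) = refl
  value-unit c₁      c₁      = refl
  value-unit c₁      pendant = refl
  value-unit pendant (inA y) = refl
  value-unit pendant (inB y) = refl
  value-unit pendant c₁      = refl
  value-unit pendant pendant = refl

  -- Walk counts and pair labels from the intersection tables

  module _ (tableᴬ tableᴮ : IntersectionTable)
    (A-table : A HasIntersections tableᴬ) (B-table : B HasIntersections tableᴮ) where

    -- Inside a part `∑-neighbours` applies to the α and β summands separately. The parts interact
    -- only through `c₁`: it adds `γ` at a port, which β can absorb because the port is the vertex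
    -- at distance `same`, and it collects one value from each port.
    ∑-edge : ∀ κ x₀ y₀ u →
      ∑ vertices (λ v → value κ x₀ y₀ v when does (edge? u v)) ≡
      value (step tableᴬ tableᴮ (distance A a x₀) (distance B b y₀) κ) x₀ y₀ u
    ∑-edge κ x₀ y₀ u = ≡-trans (∑-vertices (λ v → value κ x₀ y₀ v when does (edge? u v))) (row u)
      where
      open ≡-Reasoning
      rearrange : ∀ g p q → g + (p + q + 0) ≡ p + (g + q)
      rearrange = solve-∀
      rearrange′ : ∀ g p q → g + (p + q) ≡ p + (g + q)
      rearrange′ = solve-∀
      row : ∀ u → let g = λ v → value κ x₀ y₀ v when does (edge? u v) in
        g c₁ + (g pendant + (∑ (allFin m) (g ∘ inA) + ∑ (allFin n) (g ∘ inB))) ≡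
        value (step tableᴬ tableᴮ (distance A a x₀) (distance B b y₀) κ) x₀ y₀ u
      row (inA x) = begin
        γ κ when does (x ≟ a) +
          (∑ (allFin m) (λ z → (αᴬ κ (distance A z x₀) + βᴬ κ (distance A z a)) when does (adj? A x z)) +
           ∑ (allFin n) (λ _ → 0))
          ≡⟨ cong₂ _+_ (cong (γ κ when_) (isSame-distance A x a))
               (cong₂ _+_ (≡-trans (∑-when-+ (λ z → αᴬ κ (distance A z x₀)) (λ z → βᴬ κ (distance A z a))
                                      (λ z → does (adj? A x z)) (allFin m))
                                   (cong₂ _+_ (∑-neighbours A {tableᴬ} A-table (αᴬ κ) x x₀)
                                              (∑-neighbours A {tableᴬ} A-table (βᴬ κ) x a)))
                          (∑-zero (allFin n))) ⟩
        γ κ when isSame (distance A x a) +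
          (spread tableᴬ (αᴬ κ) (distance A x x₀) + spread tableᴬ (βᴬ κ) (distance A x a) + 0)
          ≡⟨ rearrange (γ κ when isSame (distance A x a))
               (spread tableᴬ (αᴬ κ) (distance A x x₀)) (spread tableᴬ (βᴬ κ) (distance A x a)) ⟩
        _ ∎
      row (inB y) = begin
        γ κ when does (y ≟ b) +
          (∑ (allFin m) (λ _ → 0) +
           ∑ (allFin n) (λ z → (αᴮ κ (distance B z y₀) + βᴮ κ (distance B z b)) when does (adj? B y z)))
          ≡⟨ cong₂ _+_ (cong (γ κ when_) (isSame-distance B y b))
               (cong₂ _+_ (∑-zero (allFin m))
                          (≡-trans (∑-when-+ (λ z → αᴮ κ (distance B z y₀)) (λ z → βᴮ κ (distance B z b))
                                      (λ z → does (adj? B y z)) (allFin n))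
                                   (cong₂ _+_ (∑-neighbours B {tableᴮ} B-table (αᴮ κ) y y₀)
                                              (∑-neighbours B {tableᴮ} B-table (βᴮ κ) y b)))) ⟩
        γ κ when isSame (distance B y b) +
          (spread tableᴮ (αᴮ κ) (distance B y y₀) + spread tableᴮ (βᴮ κ) (distance B y b))
          ≡⟨ rearrange′ (γ κ when isSame (distance B y b))
               (spread tableᴮ (αᴮ κ) (distance B y y₀)) (spread tableᴮ (βᴮ κ) (distance B y b)) ⟩
        _ ∎
      row c₁ = cong (δ κ +_) (cong₂ _+_
        (≡-trans (∑-select (λ x → value κ x₀ y₀ (inA x)) a)
                 (cong (λ d → αᴬ κ (distance A a x₀) + βᴬ κ d) (distance-refl A a)))
        (≡-trans (∑-select (λ y → value κ x₀ y₀ (inB y)) b)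
                 (cong (λ d → αᴮ κ (distance B b y₀) + βᴮ κ d) (distance-refl B b))))
      row pendant = ≡-trans (cong (γ κ +_) (cong₂ _+_ (∑-zero (allFin m)) (∑-zero (allFin n))))
                            (+-identityʳ (γ κ))

    -- Induction on `k` with the target fixed: its anchors stay, and only the coefficients are
    -- advanced by `step`.
    w-column : ∀ k i j → let v = vertex j in
      w (join A a B b) k i j ≡ value (column tableᴬ tableᴮ k (kind v)) (anchorᴬ v) (anchorᴮ v) (vertex i)
    w-column zero i j = begin
      w (join A a B b) 0 i j               ≡⟨ w-zero (join A a B b) i j ⟩
      1 when does (i ≟ j)
        ≡⟨ cong (1 when_) (does-⇔ (mk⇔ (cong vertex) vertex-injective) (i ≟ j) (vertex i ≟ᵛ vertex j)) ⟩
      1 when does (vertex i ≟ᵛ vertex j)   ≡⟨ value-unit (vertex i) (vertex j) ⟩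
      _ ∎
      where open ≡-Reasoning
    w-column (suc k) i j = begin
      w J (suc k) i j
        ≡⟨ w-suc J k i j ⟩
      ∑ (allFin (2 + (m + n))) (λ z → w J k z j when does (adj? J i z))
        ≡⟨ ∑-cong (λ z → cong (_when does (adj? J i z)) (w-column k z j)) (allFin (2 + (m + n))) ⟩
      ∑ (allFin (2 + (m + n))) (λ z → value κ x₀ y₀ (vertex z) when does (adj? J i z))
        ≡⟨ ∑-adjacent (value κ x₀ y₀) i ⟩
      ∑ vertices (λ v → value κ x₀ y₀ v when does (edge? (vertex i) v))
        ≡⟨ ∑-edge κ x₀ y₀ (vertex i) ⟩
      value (step tableᴬ tableᴮ (distance A a x₀) (distance B b y₀) κ) x₀ y₀ (vertex i)
        -- `∑-edge` measures from the ports to the anchors, whereas the kind of the target records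
        -- the distances from the anchors to the ports.
        ≡⟨ cong₂ (λ s t → value (step tableᴬ tableᴮ s t κ) x₀ y₀ (vertex i))
             (≡-trans (distance-sym A a x₀) (distance-anchorᴬ (vertex j)))
             (≡-trans (distance-sym B b y₀) (distance-anchorᴮ (vertex j))) ⟩
      value (column tableᴬ tableᴮ (suc k) (kind (vertex j))) x₀ y₀ (vertex i) ∎
      where
      open ≡-Reasoning
      J = join A a B b
      κ = column tableᴬ tableᴮ k (kind (vertex j))
      x₀ = anchorᴬ (vertex j)
      y₀ = anchorᴮ (vertex j)

    -- Over one part, the distances from the anchor of `u` to `z` and from `z` to the port form the
    -- table row at the distance from anchor to port, which the kind of `u` determines.
    pairType-vertices : ∀ u → map (pairType u) vertices ↭ pairTypes tableᴬ tableᴮ (kind u)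
    pairType-vertices u = begin
      map (pairType u) vertices
        ≡⟨ cong (λ ps → pairType u c₁ ∷ pairType u pendant ∷ ps)
             (≡-trans (map-++ (pairType u) (map inA (allFin m)) (map inB (allFin n)))
               (cong₂ _++_
                 (≡-trans (sym (map-∘ (allFin m)))
                   (≡-trans (map-cong (pairType-inA u) (allFin m)) (map-∘ (allFin m))))
                 (≡-trans (sym (map-∘ (allFin n)))
                   (≡-trans (map-cong (pairType-inB u) (allFin n)) (map-∘ (allFin n)))))) ⟩
      pairType u c₁ ∷ pairType u pendant ∷
        map (toA u) (map (λ z → distance A (anchorᴬ u) z , distance A z a) (allFin m)) ++
        map (toB u) (map (λ z → distance B (anchorᴮ u) z , distance B z b) (allFin n))
        ↭⟨ prep _ (prep _ (++⁺ (map⁺ (toA u) (A-table (anchorᴬ u) a)) (map⁺ (toB u) (B-table (anchorᴮ u) b)))) ⟩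
      pairType u c₁ ∷ pairType u pendant ∷
        map (toA u) (tableᴬ (distance A (anchorᴬ u) a)) ++
        map (toB u) (tableᴮ (distance B (anchorᴮ u) b))
        ≡⟨ cong₂ (λ s t → pairType u c₁ ∷ pairType u pendant ∷ map (toA u) (tableᴬ s) ++ map (toB u) (tableᴮ t))
             (distance-anchorᴬ u) (distance-anchorᴮ u) ⟩
      pairType u c₁ ∷ pairType u pendant ∷
        map (toA u) (tableᴬ (portDistanceᴬ (kind u))) ++ map (toB u) (tableᴮ (portDistanceᴮ (kind u)))
        ≡⟨ cong (λ d → (kind u , c₁ , d) ∷ (kind u , pendant , d) ∷
                   map (toA u) (tableᴬ (portDistanceᴬ (kind u))) ++ map (toB u) (tableᴮ (portDistanceᴮ (kind u))))
             (gap-port u) ⟩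
      pairTypes tableᴬ tableᴮ (kind u) ∎
      where
      open PermutationReasoning
      toA toB : Vertex → Distance × Distance → PairType
      toA u (s , t) = kind u , inA t , gapᴬ (kind u) s
      toB u (s , t) = kind u , inB t , gapᴮ (kind u) s
      pairType-inA : ∀ u z → pairType u (inA z) ≡ toA u (distance A (anchorᴬ u) z , distance A z a)
      pairType-inA (inA x) z = refl
      pairType-inA (inB y) z = refl
      pairType-inA c₁      z = refl
      pairType-inA pendant z = refl
      pairType-inB : ∀ u z → pairType u (inB z) ≡ toB u (distance B (anchorᴮ u) z , distance B z b)
      pairType-inB (inA x) z = refl
      pairType-inB (inB y) z = refl
      pairType-inB c₁      z = refl
      pairType-inB pendant z = refl
      gap-port : ∀ u → gap a b u ≡ gapᴬ (kind u) (portDistanceᴬ (kind u))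
      gap-port (inA x) = refl
      gap-port (inB y) = refl
      gap-port c₁      = refl
      gap-port pendant = refl

    pairTypes-complete : ∀ i →
      map (pairType (vertex i) ∘ vertex) (allFin (2 + (m + n))) ↭ pairTypes tableᴬ tableᴮ (kind (vertex i))
    pairTypes-complete i = trans
      (↭-reflexive (≡-trans (map-∘ (allFin (2 + (m + n)))) (cong (map (pairType (vertex i))) map-vertex)))
      (pairType-vertices (vertex i))

-- Walk counts and multisets of pair labels are computed from the tables alone, and the two joins
-- share their tables.
sameΩ-join : ∀ {m n} {tableᴬ tableᴮ : IntersectionTable} {A A′ : Graph m} {B B′ : Graph n} →
  A HasIntersections tableᴬ → A′ HasIntersections tableᴬ →
  B HasIntersections tableᴮ → B′ HasIntersections tableᴮ →
  ∀ a a′ b b′ r → SameΩ r (join A a B b) (join A′ a′ B′ b′)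
sameΩ-join {m} {n} {tableᴬ} {tableᴮ} {A} {A′} {B} {B′} hA hA′ hB hB′ a a′ b b′ =
  sameΩ (join A a B b) (join A′ a′ B′ b′)
    (kind A a B b ∘ Join.vertex A a B b) (kind A′ a′ B′ b′ ∘ Join.vertex A′ a′ B′ b′)
    (λ i → pairType A a B b (vertex i) ∘ vertex) (λ i → pairType A′ a′ B′ b′ (vertex′ i) ∘ vertex′)
    (λ {i} {i′} eq → ≡-trans (pairType-loop A a B b (vertex i))
      (≡-trans (cong (λ k → k , k , same) eq) (sym (pairType-loop A′ a′ B′ b′ (vertex′ i′)))))
    (cong (proj₁ ∘ proj₂))
    walks
    (λ {i} {i′} → pairs i i′)
    -- Index `zero` is `c₁` in both joins, so its outgoing pair labels agree; their middle
    -- components are the kinds of all vertices.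
    (subst₂ _↭_ (sym (map-∘ (allFin (2 + (m + n))))) (sym (map-∘ (allFin (2 + (m + n)))))
      (map⁺ (proj₁ ∘ proj₂) (pairs zero zero refl)))
  where
  open Join A a B b using (vertex)
  open Join A′ a′ B′ b′ using () renaming (vertex to vertex′)
  walks : ∀ {i j i′ j′} →
    pairType A a B b (vertex i) (vertex j) ≡ pairType A′ a′ B′ b′ (vertex′ i′) (vertex′ j′) →
    ∀ k → w (join A a B b) k i j ≡ w (join A′ a′ B′ b′) k i′ j′
  walks {i} {j} {i′} {j′} eq k = begin
    w (join A a B b) k i j      ≡⟨ w-column A a B b tableᴬ tableᴮ hA hB k i j ⟩
    entry (pairType A a B b (vertex i) (vertex j))         ≡⟨ cong entry eq ⟩
    entry (pairType A′ a′ B′ b′ (vertex′ i′) (vertex′ j′)) ≡⟨ w-column A′ a′ B′ b′ tableᴬ tableᴮ hA′ hB′ k i′ j′ ⟨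
    w (join A′ a′ B′ b′) k i′ j′ ∎
    where
    open ≡-Reasoning
    entry : PairType → ℕ
    entry (s , t , d) = evaluate (column tableᴬ tableᴮ k t) s d
  pairs : ∀ i i′ → kind A a B b (vertex i) ≡ kind A′ a′ B′ b′ (vertex′ i′) →
    map (pairType A a B b (vertex i) ∘ vertex) (allFin (2 + (m + n))) ↭
    map (pairType A′ a′ B′ b′ (vertex′ i′) ∘ vertex′) (allFin (2 + (m + n)))
  pairs i i′ eq = trans (pairTypes-complete A a B b tableᴬ tableᴮ hA hB i)
    (trans (↭-reflexive (cong (pairTypes tableᴬ tableᴮ) eq))
      (↭-sym (pairTypes-complete A′ a′ B′ b′ tableᴬ tableᴮ hA′ hB′ i′)))

-- Color refinement

↭ₛ-lift : ∀ (S : Setoid 0ℓ 0ℓ) → let open Setoid S in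
  ∀ (f : X → Carrier) (g : Y → Carrier) {xs ys} → Setoid._≈_ (Multiset S) (map f xs) (map g ys) →
  ∀ {x} → x ∈ xs → ∃[ y ] y ∈ ys × f x ≈ g y
↭ₛ-lift S f g fxs↭gys {x} x∈xs = find (Any.map⁻ (Permₛ.Any-resp-↭ S (λ u≈v fx≈u → S.trans fx≈u u≈v) fxs↭gys
  (Any.map (λ { refl → S.refl }) (∈-map⁺ f x∈xs))))
  where module S = Setoid S

module _ (K : Setoid 0ℓ 0ℓ) {m n : ℕ} (G : Graph m) (H : Graph n)
  (c : Fin m → Setoid.Carrier K) (d : Fin n → Setoid.Carrier K) where

  infix 4 _≈[_]_
  _≈[_]_ : Fin m → ℕ → Fin n → Set
  x ≈[ r ] y = Setoid._≈_ (Color K r) (C K G c r x) (C K H d r y)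

  color-≈ : ∀ r {x y} → x ≈[ r ] y → x ≈[ 0 ] y
  color-≈ zero    p       = p
  color-≈ (suc r) (p , _) = color-≈ r p

  degree-≈ : ∀ r {x y} → x ≈[ suc r ] y → length (neighbours G x) ≡ length (neighbours H y)
  degree-≈ r {x} {y} (_ , p) = subst₂ _≡_ (length-map (C K G c r) (neighbours G x))
    (length-map (C K H d r) (neighbours H y)) (Permₛ.xs↭ys⇒|xs|≡|ys| (Color K r) p)

  -- A move along an edge costs one round, as a color contains the multiset of the neighbours'
  -- colors of the round before.
  neighbour-≈ : ∀ r {x y x′} → x ≈[ suc r ] y → Adj G x x′ → ∃[ y′ ] Adj H y y′ × x′ ≈[ r ] y′
  neighbour-≈ r {x} {y} {x′} (_ , p) e
    with ↭ₛ-lift (Color K r) (C K G c r) (C K H d r) p (∈-filter⁺ (adj? G x) (∈-allFin x′) e)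
  ... | y′ , y′∈ , q = y′ , proj₂ (∈-filter⁻ (adj? H y) {xs = allFin n} y′∈) , q

-- Port triangles as an invariant of color refinement

module _ {n : ℕ} (G : Graph n) where

  -- Ports are recognised by their degree 7.
  NearPort : Fin n → Set
  NearPort x = ∃[ p ] Adj G x p × length (neighbours G p) ≡ 7

  -- In the presence of a single vertex of color true, this says that y lies in a triangle through that
  -- vertex, all of whose vertices are near a port.
  InPortTriangle : (Fin n → Bool) → Fin n → Set
  InPortTriangle c y =
    (∃[ s ] Adj G y s × c s ≡ true × NearPort s) × NearPort y ×
    (∃[ z ] Adj G y z × NearPort z × ∃[ s ] Adj G z s × c s ≡ true)

module _ {m n : ℕ} (G : Graph m) (H : Graph n) {c : Fin m → Bool} {d : Fin n → Bool} where

  private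
    _≈⟨_⟩_ : Fin m → ℕ → Fin n → Set
    _≈⟨_⟩_ = _≈[_]_ (setoid Bool) G H c d

    neighbour : ∀ r {x y x′} → x ≈⟨ suc r ⟩ y → Adj G x x′ → ∃[ y′ ] Adj H y y′ × x′ ≈⟨ r ⟩ y′
    neighbour = neighbour-≈ (setoid Bool) G H c d

    colored : ∀ r {x y} → x ≈⟨ r ⟩ y → c x ≡ true → d y ≡ true
    colored r p cx = ≡-trans (sym (color-≈ (setoid Bool) G H c d r p)) cx

    nearPort : ∀ r {x y} → x ≈⟨ 2 + r ⟩ y → NearPort G x → NearPort H y
    nearPort r x≈y (p , x~p , deg) with neighbour (suc r) x≈y x~p
    ... | q , y~q , p≈q = q , y~q , ≡-trans (sym (degree-≈ (setoid Bool) G H c d r p≈q)) deg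

  -- The property consists of existential moves along edges, which transfer one at a time. The
  -- longest chain goes to `z`, then to a port, then reads its degree: three rounds.
  inPortTriangle-≈ : ∀ r {x y} → _≈[_]_ (setoid Bool) G H c d x (3 + r) y →
    InPortTriangle G c x → InPortTriangle H d y
  inPortTriangle-≈ r x≈y ((s , x~s , cs , near-s) , near-x , (z , x~z , near-z , s′ , z~s′ , cs′))
    with neighbour (2 + r) x≈y x~s | neighbour (2 + r) x≈y x~z
  ... | t , y~t , s≈t | u , y~u , z≈u with neighbour (1 + r) z≈u z~s′
  ...   | t′ , u~t′ , s′≈t′ =
    (t , y~t , colored (2 + r) s≈t cs , nearPort r s≈t near-s) ,
    nearPort r (proj₁ x≈y) near-x ,
    (u , y~u , nearPort r z≈u near-z , t′ , u~t′ , colored (1 + r) s′≈t′ cs′)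

-- The outer multiset matches the individualized vertices, the inner one the vertices of the colored
-- graphs. The number of rounds is the order, so order `3 + k` provides the three rounds.
sameWL₃/₂⇒inPortTriangle : ∀ {k} (G H : Graph (3 + k)) → SameWL₃/₂ G H →
  ∀ x y → InPortTriangle G (individualize x) y → ∃₂ λ x′ y′ → InPortTriangle H (individualize x′) y′
sameWL₃/₂⇒inPortTriangle {k} G H G≈H x y t
  with ↭ₛ-lift (Multiset (Color (setoid Bool) (3 + k)))
         (λ x → WL₁ (setoid Bool) G (individualize x)) (λ x → WL₁ (setoid Bool) H (individualize x))
         G≈H (∈-allFin x)
... | x′ , _ , p
  with ↭ₛ-lift (Color (setoid Bool) (3 + k)) (C (setoid Bool) G (individualize x) (3 + k))
         (C (setoid Bool) H (individualize x′) (3 + k)) p (∈-allFin y)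
...   | y′ , _ , q = x′ , y′ , inPortTriangle-≈ G H k q t

portTriangle-separates : ∀ {k} (G H : Graph (3 + k)) → (∀ r → SameΩ r G H) →
  (∃₂ λ x y → InPortTriangle G (individualize x) y) → (∀ x y → ¬ InPortTriangle H (individualize x) y) →
  Separates G H
portTriangle-separates {k} G H G≈H (x , y , t) ∉H = G≈H (3 + k) , G≈H , λ eq →
  let x′ , y′ , t′ = sameWL₃/₂⇒inPortTriangle G H eq x y t in ∉H x′ y′ t′

individualize-self : ∀ {n} (x : Fin n) → individualize x x ≡ true
individualize-self x = dec-true (x ≟ x) refl

individualize-true : ∀ {n} {x y : Fin n} → individualize x y ≡ true → y ≡ x
individualize-true {x = x} {y} eq with yes p ← y ≟ x = p

-- Cliques through the ports of a join

InK₄ : ∀ {n} → Graph n → Fin n → Set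
InK₄ G p = ∃[ x ] Adj G x p × ∃[ y ] (Adj G y p × Adj G y x) × ∃[ z ] (Adj G z p × Adj G z x × Adj G y z)

inK₄? : ∀ {n} (G : Graph n) p → Dec (InK₄ G p)
inK₄? G p = any? λ x → adj? G x p ×-dec any? λ y → (adj? G y p ×-dec adj? G y x) ×-dec
            any? λ z → adj? G z p ×-dec adj? G z x ×-dec adj? G y z

-- The neighbours of a vertex induce a hexagon here, while in the rook's graph every row is a clique
-- of size 4. Both claims are settled by exhaustive search.
shrikhande-∉K₄ : ∀ p → ¬ InK₄ shrikhande p
shrikhande-∉K₄ = from-yes (all? λ p → ¬? (inK₄? shrikhande p))

rook-∈K₄ : ∀ p → InK₄ rook p
rook-∈K₄ = from-yes (all? (inK₄? rook))

distance-same : ∀ {n} (G : Graph n) {x y} → distance G x y ≡ same → x ≡ y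
distance-same G {x} {y} eq with x ≟ y
... | yes p = p
... | no _ with does (adj? G x y)
distance-same G () | no _ | true
distance-same G () | no _ | false

-- The all-ones vector: one application of the adjacency matrix turns it into the degrees.
ones : Column
ones = λ where .αᴬ _ → 0 ; .βᴬ _ → 1 ; .αᴮ _ → 0 ; .βᴮ _ → 1 ; .γ → 1 ; .δ → 1

module _ {m n : ℕ} {A : Graph m} {B : Graph n}
  (A-srg : A HasIntersections srg-16-6-2-2) (B-srg : B HasIntersections srg-16-6-2-2)
  (a : Fin m) (b : Fin n) where

  open Join A a B b hiding (graph)

  private
    J : Graph (2 + (m + n))
    J = join A a B b

    degree : Vertex → ℕ
    degree v = value A a B b
      (step srg-16-6-2-2 srg-16-6-2-2 (distance A a a) (distance B b b) ones) a b v

    length-neighbours : ∀ i → length (neighbours J i) ≡ degree (vertex i)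
    length-neighbours i = begin
      length (neighbours J i)
        ≡⟨ length-filter-∑ (adj? J i) (allFin (2 + (m + n))) ⟩
      ∑ (allFin (2 + (m + n))) (λ z → 1 when does (adj? J i z))
        ≡⟨ ∑-cong (λ z → cong (_when does (adj? J i z)) (value-ones (vertex z))) (allFin (2 + (m + n))) ⟨
      ∑ (allFin (2 + (m + n))) (λ z → value A a B b ones a b (vertex z) when does (adj? J i z))
        ≡⟨ ∑-adjacent A a B b (value A a B b ones a b) i ⟩
      ∑ (vertices A a B b) (λ v → value A a B b ones a b v when does (edge? (vertex i) v))
        ≡⟨ ∑-edge A a B b srg-16-6-2-2 srg-16-6-2-2 A-srg B-srg ones a b (vertex i) ⟩
      degree (vertex i) ∎
      where
      open ≡-Reasoning
      value-ones : ∀ v → value A a B b ones a b v ≡ 1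
      value-ones (inA x) = refl
      value-ones (inB y) = refl
      value-ones c₁      = refl
      value-ones pendant = refl

    degree-portᴮ : degree (inB b) ≡ 7
    degree-portᴮ with distance B b b | distance-refl B b
    ... | _ | refl = refl

    -- A port has 6 neighbours in its part and also `c₁`. Other vertices of the parts have degree 6,
    -- `c₁` has 3 and `pendant` has 1.
    degree-7 : ∀ v → degree v ≡ 7 → v ≡ inA a ⊎ v ≡ inB b
    degree-7 (inA x) deg with distance A x a in eq
    ... | same     = inj₁ (cong inA (distance-same A eq))
    degree-7 (inA x) () | adjacent
    degree-7 (inA x) () | far
    degree-7 (inB y) deg with distance B y b in eq
    ... | same     = inj₂ (cong inB (distance-same B eq))
    degree-7 (inB y) () | adjacent
    degree-7 (inB y) () | far

    Near : Vertex → Set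
    Near (inA x) = Adj A x a
    Near (inB y) = Adj B y b
    Near c₁      = ⊤
    Near pendant = ⊥

    nearPort⇒near : ∀ i → NearPort J i → Near (vertex i)
    nearPort⇒near i (p , i~p , deg)
      with vertex p | i~p | degree-7 (vertex p) (≡-trans (sym (length-neighbours p)) deg)
    ... | _ | e | inj₁ refl = portᴬ (vertex i) e
      where
      portᴬ : ∀ v → Edge v (inA a) → Near v
      portᴬ (inA x) e = e
      portᴬ c₁      _ = tt
    ... | _ | e | inj₂ refl = portᴮ (vertex i) e
      where
      portᴮ : ∀ v → Edge v (inB b) → Near v
      portᴮ (inB y) e = e
      portᴮ c₁      _ = tt

    -- In a part only the port is adjacent to `c₁`, and it is not its own neighbour.
    near-≁c₁ : ∀ v → Near v → ¬ Edge v c₁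
    near-≁c₁ (inA x) near refl = irreflexive A refl near
    near-≁c₁ (inB y) near refl = irreflexive B refl near

    -- Without `c₁` a triangle stays inside one part and completes to a `K₄` with the port there;
    -- `near-≁c₁` rules out `c₁`.
    no-near-triangle : ¬ InK₄ A a → ¬ InK₄ B b → ∀ s y z → Near s → Near y → Near z →
      Edge y s → Edge z s → Edge y z → ⊥
    no-near-triangle ∉A ∉B (inA s) (inA y) (inA z) ns ny nz ys zs yz =
      ∉A (s , ns , y , (ny , ys) , z , nz , zs , yz)
    no-near-triangle ∉A ∉B (inB s) (inB y) (inB z) ns ny nz ys zs yz =
      ∉B (s , ns , y , (ny , ys) , z , nz , zs , yz)
    no-near-triangle ∉A ∉B c₁      y       z       ns ny nz ys zs yz = near-≁c₁ y ny ys
    no-near-triangle ∉A ∉B (inA s) c₁      z       ns ny nz ys zs yz = near-≁c₁ (inA s) ns ys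
    no-near-triangle ∉A ∉B (inB s) c₁      z       ns ny nz ys zs yz = near-≁c₁ (inB s) ns ys
    no-near-triangle ∉A ∉B (inA s) (inA y) c₁      ns ny nz ys zs yz = near-≁c₁ (inA y) ny yz
    no-near-triangle ∉A ∉B (inB s) (inB y) c₁      ns ny nz ys zs yz = near-≁c₁ (inB y) ny yz

  ∉K₄⇒∉portTriangle : ¬ InK₄ A a → ¬ InK₄ B b → ∀ i j → ¬ InPortTriangle J (individualize i) j
  ∉K₄⇒∉portTriangle ∉A ∉B i j ((s , j~s , cs , near-s) , near-j , z , j~z , near-z , t , z~t , ct)
    -- Only `i` has color `true`, so `s` and `t` coincide and the path closes to a triangle.
    with refl ← individualize-true {x = i} {s} cs | refl ← individualize-true {x = i} {t} ct =
    no-near-triangle ∉A ∉B (vertex s) (vertex j) (vertex z)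
      (nearPort⇒near s near-s) (nearPort⇒near j near-j) (nearPort⇒near z near-z) j~s z~t j~z

  ∈K₄⇒∈portTriangle : InK₄ B b → ∃₂ λ i j → InPortTriangle J (individualize i) j
  ∈K₄⇒∈portTriangle (x , x~b , y , (y~b , y~x) , z , z~b , z~x , y~z) =
    -- The triangle is the clique without its port, with `x` individualized.
    i x , i y , (i x , adj y~x , individualize-self (i x) , near x~b) , near y~b ,
    (i z , adj y~z , near z~b , i x , adj z~x , individualize-self (i x))
    where
    i : Fin n → Fin (2 + (m + n))
    i v = suc (suc (m ↑ʳ v))
    adj : ∀ {u v} → Adj B u v → Adj J (i u) (i v)
    adj {u} {v} = subst₂ Edge (sym (vertex-↑ʳ A a B b u)) (sym (vertex-↑ʳ A a B b v))
    near : ∀ {v} → Adj B v b → NearPort J (i v)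
    near v~b = i b , adj v~b ,
      ≡-trans (length-neighbours (i b)) (≡-trans (cong degree (vertex-↑ʳ A a B b b)) degree-portᴮ)

-- The separating pairs of joins

separates : ∀ {n} {A B : Graph n} → A HasIntersections srg-16-6-2-2 → B HasIntersections srg-16-6-2-2 →
  ∀ {a b} → ¬ InK₄ A a → InK₄ B b → Separates (join A a B b) (join A a A a)
-- The vertex `a` excludes `n = 0`, which gives the joins an order of the form `3 + k`.
separates {suc n} {A} {B} A-srg B-srg {a} {b} ∉A ∈B = portTriangle-separates (join A a B b) (join A a A a)
  (sameΩ-join {tableᴬ = srg-16-6-2-2} {srg-16-6-2-2} A-srg A-srg B-srg A-srg a a b a)
  (∈K₄⇒∈portTriangle A-srg B-srg a b ∈B)
  (∉K₄⇒∉portTriangle A-srg A-srg a a ∉A ∉A)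

-- All arguments of separates are given, since otherwise unification unfolds Separates at order 34,
-- where the types of the invariants are exponentially large.
separates-shrikhande-rook : ∀ (a b : Fin 16) →
  Separates (join shrikhande a rook b) (join shrikhande a shrikhande a)
separates-shrikhande-rook a b =
  separates {16} {shrikhande} {rook} shrikhande-srg rook-srg {a} {b} (shrikhande-∉K₄ a) (rook-∈K₄ b)

theorem6p5 : (∃[ n ] ∃[ G ] ∃[ H ] Separates {n} G H)
    × (∀ (a b : Fin 16) →
    Separates (join shrikhande a rook b) (join shrikhande a shrikhande a))
theorem6p5 =
  (_ , join shrikhande zero rook zero , join shrikhande zero shrikhande zero ,
   separates-shrikhande-rook zero zero) ,
  separates-shrikhande-rook
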